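{- For every integer $k\geq 4$ with $k\equiv 1 \pmod 3$ there exist a constant $c_k>0$ (depending only on $k$) and a sequence $(f_n)_{n\geq 1}$, where each $f_n:\{0,1\}^{n^k}\rightarrow\{0,1\}$ is a non-constant $k$-partite $k$-uniform hypergraph property, such that $s(f_n)\leq c_k\, n^{\lceil k/3\rceil-1/2}$ for all $n\geq 1$; that is, $s(f_n)=O(n^{\lceil k/3\rceil-1/2})$.
   Context: For a Boolean function $f:\{0,1\}^N\rightarrow\{0,1\}$ and an input $x\in\{0,1\}^N$, let $x^{\{i\}}$ denote $x$ with its $i$-th bit flipped. The sensitivity of $f$ on $x$ is $s(f,x)=|\{i : f(x)\neq f(x^{\{i\}})\}|$, and the sensitivity of $f$ is $s(f)=\max_x s(f,x)$. Index the variables of $f:\{0,1\}^{n^k}\rightarrow\{0,1\}$ by tuples $(i_1,\dots,i_k)\in[n]^k$, where $[n]=\{1,\dots,n\}$ (so an input encodes a $k$-partite $k$-uniform hypergraph with $n$ vertices in each part). The function $f$ is called a $k$-partite $k$-uniform hypergraph property if for every input $x=(x_{(i_1,\dots,i_k)})$ and all permutations $\sigma_1,\dots,\sigma_k\in S_n$, $f\big((x_{(i_1,\dots,i_k)})_{(i_1,\dots,i_k)}\big)=f\big((x_{(\sigma_1(i_1),\dots,\sigma_k(i_k))})_{(i_1,\dots,i_k)}\big)$. -}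

module Defs where

open import Data.Bool.Base using (Bool; true; false; not)
open import Data.Bool.Properties using (_≟_)
open import Data.Fin.Base using (Fin; finToFun; funToFin)
open import Data.Fin.Permutation using (Permutation′; _⟨$⟩ʳ_)
open import Data.List.Base as List using (List; _++_)
open import Data.List.Extrema.Nat using (max)
open import Data.List.Membership.Propositional using (_∈_)
open import Data.List.Membership.Propositional.Properties using (∈-map⁺; ∈-++⁺ˡ; ∈-++⁺ʳ)
open import Data.List.Relation.Unary.Any using (here)
open import Data.Nat.Base using (ℕ; zero; suc; _+_; _^_; _/_)
open import Data.Product.Base using (∃₂)
open import Data.Vec.Base using (Vec; []; _∷_; _[_]%=_; allFin; count; lookup; tabulate)
open import Relation.Binary.PropositionalEquality using (_≡_; _≢_; refl)
open import Relation.Nullary.Decidable using (¬?)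

Input : ℕ → Set
Input N = Vec Bool N

BooleanFunction : ℕ → Set
BooleanFunction N = Input N → Bool

NonConstant : ∀ {N} → BooleanFunction N → Set
NonConstant f = ∃₂ λ x y → f x ≢ f y

flip : ∀ {N} → Input N → Fin N → Input N
flip x i = x [ i ]%= not

sensitivityAt : ∀ {N} → BooleanFunction N → Input N → ℕ
sensitivityAt {N} f x = count (λ i → ¬? (f x ≟ f (flip x i))) (allFin N)

allInputs : ∀ N → List (Input N)
allInputs zero    = List.[ [] ]
allInputs (suc N) = List.map (false ∷_) (allInputs N) ++ List.map (true ∷_) (allInputs N)

∈-allInputs : ∀ {N} (x : Input N) → x ∈ allInputs N
∈-allInputs []          = here refl
∈-allInputs (false ∷ x) = ∈-++⁺ˡ (∈-map⁺ (false ∷_) (∈-allInputs x))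
∈-allInputs (true  ∷ x) = ∈-++⁺ʳ _ (∈-map⁺ (true ∷_) (∈-allInputs x))

-- The base value 0 is harmless: allInputs N is never empty.
sensitivity : ∀ {N} → BooleanFunction N → ℕ
sensitivity {N} f = max 0 (List.map (sensitivityAt f) (allInputs N))

-- The variable x_{(i₁,…,iₖ)} is stored at position funToFin (i₁,…,iₖ) of
-- x : Input (n ^ k); funToFin and finToFun are mutually inverse bijections
-- between (Fin k → Fin n) and Fin (n ^ k).  The result of relabel σ x has
-- the value x_{(σ₁(i₁),…,σₖ(iₖ))} at (i₁,…,iₖ).
relabel : ∀ {k n} → (Fin k → Permutation′ n) → Input (n ^ k) → Input (n ^ k)
relabel {k} {n} σ x =
  tabulate λ p → lookup x (funToFin λ l → σ l ⟨$⟩ʳ finToFun {n} {k} p l)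

IsHypergraphProperty : ∀ k n → BooleanFunction (n ^ k) → Set
IsHypergraphProperty k n f =
  ∀ (x : Input (n ^ k)) (σ : Fin k → Permutation′ n) → f x ≡ f (relabel σ x)

⌈_/3⌉ : ℕ → ℕ
⌈ k /3⌉ = (k + 2) / 3

{-# OPTIONS --safe #-}
module Submission where

-- Let k = 3m + 1, M = n ^ m, r = ⌊√n⌋, and split an index into (a , b , c , w) with
-- a, b, c < M and w < n.  For n ≥ 9, f_n accepts x iff x fits some pattern: a slice a,
-- six rows B, six columns C and r layers W such that in each layer of W the rows are 0
-- off C, the columns are 1 off B and B × C carries a fixed matrix, while in all other
-- layers B × C is 0.  A pattern prescribes O(M r + n) bits, which bounds the sensitivity
-- at accepted inputs.  Two different patterns with the same slice and a common layer
-- contradict each other in at least three bits.  So if x is rejected and flipping i ≠ j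
-- gave inputs fitting patterns with the same slice and a common layer, the two patterns
-- would coincide and x itself would fit.  Hence the s sensitive bits of x use disjoint
-- sets of r pairs (a , w), and s r ≤ M n.

open import Defs
open import Data.Bool.Base using (Bool; true; false; not; _xor_)
open import Data.Bool.Properties as Bool using (not-¬; ¬-not)
open import Data.Fin.Base using
  (Fin; zero; suc; toℕ; fromℕ<; combine; remQuot; inject≤; _↑ˡ_; _↑ʳ_; finToFun; funToFin)
open import Data.Fin.Patterns using (0F; 1F; 2F)
open import Data.Fin.Permutation using (Permutation′; permutation; _⟨$⟩ʳ_; _⟨$⟩ˡ_; inverseˡ; inverseʳ)
open import Data.Fin.Properties using
  (_≟_; any?; all?; ¬∀⟶∃¬; injective⇒≤; inject≤-injective; ↑ʳ-injective; suc-injective; *↔×; +↔⊎;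
   combine-injectiveˡ; combine-injectiveʳ; combine-remQuot; remQuot-combine; finToFun-funToFin; funToFin-finToFin)
open import Data.List.Extrema.Nat using (max≤v⁺)
open import Data.List.Relation.Unary.All using (universal)
import Data.List.Relation.Unary.All.Properties as All
open import Data.Nat.Base using
  (ℕ; zero; suc; _+_; _*_; _∸_; _^_; _/_; _%_; _≤_; _<_; _≥_; z≤n; s≤s; >-nonZero)
open import Data.Nat.DivMod using (m≡m%n+[m/n]*n; m*n/n≡m)
open import Data.Nat.Properties hiding (_≟_; suc-injective)
open import Data.Nat.Tactic.RingSolver using (solve-∀)
open import Data.Product.Base using (∃; _×_; _,_; proj₁; proj₂; uncurry; ∃-syntax; Σ-syntax)
open import Data.Product.Function.NonDependent.Propositional using (_×-↔_)
open import Data.Sum.Base using (_⊎_; inj₁; inj₂)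
open import Data.Sum.Function.Propositional using (_⊎-↔_)
open import Data.Unit.Base using (tt)
open import Data.Vec.Base using (Vec; []; _∷_; allFin; count; lookup; tabulate; map)
import Data.Vec.Membership.DecPropositional as DecMembership
open import Data.Vec.Membership.Propositional using (_∈_; _∉_)
open import Data.Vec.Membership.Propositional.Properties using (∈-lookup; ∈-map⁺)
open import Data.Vec.Properties using (lookup-map; lookup∘tabulate; lookup-allFin; lookup∘updateAt′; count≤n)
open import Data.Vec.Relation.Unary.AllPairs using (allPairs?)
open import Data.Vec.Relation.Unary.Any using (index)
open import Data.Vec.Relation.Unary.Any.Properties using (lookup-index)
open import Data.Vec.Relation.Unary.Unique.Propositional using (Unique)
import Data.Vec.Relation.Unary.Unique.Propositional.Properties as Unique
open import Function.Base using (_∘_)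
open import Function.Bundles using (_↔_; Inverse; Injection; mk⇔)
open import Function.Definitions using (Injective)
open import Function.Properties.Inverse using (↔-refl; ↔-sym; ↔-trans; ↔⇒↣)
open import Relation.Binary.PropositionalEquality using
  (_≡_; _≢_; _≗_; refl; sym; trans; cong; cong₂; subst; module ≡-Reasoning)
open import Relation.Nullary.Decidable using
  (Dec; yes; no; does; map′; ¬?; _×-dec_; _⊎-dec_; _→-dec_; toWitness; does-⇔; dec-true; decidable-stable)
open import Relation.Nullary.Negation using (¬_; contradiction)
open import Relation.Unary using (Pred; Decidable)

private
  variable
    k l m n N M r : ℕ

open module FinMembership {M} = DecMembership (_≟_ {M}) using (_∈?_)

-- Pigeonhole, finite search and counting by injections

-- Pigeonhole: otherwise choosing for each `v` an `s` with `g v ≡ h s` would inject `Fin l` into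
-- `Fin k`.
avoid : k < l → {g : Fin l → Fin N} → Injective _≡_ _≡_ g → (h : Fin k → Fin N) →
  ∃ λ v → ∀ s → g v ≢ h s
avoid {k} {l} k<l {g} g-injective h =
  let v , ¬hit = ¬∀⟶∃¬ l _ (λ v → any? λ s → g v ≟ h s) ¬all-hit
  in  v , λ s g≡h → ¬hit (s , g≡h)
  where
  ¬all-hit : ¬ (∀ v → ∃ λ s → g v ≡ h s)
  ¬all-hit hit = <⇒≱ k<l (injective⇒≤ {f = proj₁ ∘ hit} λ {u} {v} eq → g-injective
    (trans (proj₂ (hit u)) (trans (cong h eq) (sym (proj₂ (hit v))))))

anyVec? : ∀ k {p} {P : Pred (Vec (Fin N) k) p} → Decidable P → Dec (∃ P)
anyVec? zero    P? = map′ ([] ,_) (λ { ([] , p) → p }) (P? [])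
anyVec? (suc k) P? = map′ (λ (b , B , p) → b ∷ B , p) (λ { (b ∷ B , p) → b , B , p })
  (any? λ b → anyVec? k λ B → P? (b ∷ B))

module _ {p} {P : Pred (Fin N) p} (P? : Decidable P) where

  witness : (xs : Vec (Fin N) k) → Fin (count P? xs) → Fin k
  witness (x ∷ xs) j with P? x
  witness (x ∷ xs) j       | no _  = suc (witness xs j)
  witness (x ∷ xs) zero    | yes _ = zero
  witness (x ∷ xs) (suc j) | yes _ = suc (witness xs j)

  witness-holds : (xs : Vec (Fin N) k) (j : Fin (count P? xs)) → P (lookup xs (witness xs j))
  witness-holds (x ∷ xs) j with P? x
  witness-holds (x ∷ xs) j       | no _   = witness-holds xs j
  witness-holds (x ∷ xs) zero    | yes px = px
  witness-holds (x ∷ xs) (suc j) | yes _  = witness-holds xs j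

  witness-injective : (xs : Vec (Fin N) k) → Injective _≡_ _≡_ (witness xs)
  witness-injective (x ∷ xs) {i} {j} eq with P? x
  witness-injective (x ∷ xs) eq                   | no _  = witness-injective xs (suc-injective eq)
  witness-injective (x ∷ xs) {zero}  {zero}  eq   | yes _ = refl
  witness-injective (x ∷ xs) {suc i} {suc j} eq   | yes _ =
    cong suc (witness-injective xs (suc-injective eq))

  -- The images of the `g p` are disjoint sets of size `r`, so the pairs of a counted index and an
  -- element of `Fin r` inject into `Fin M`.
  count*≤ : (g : ∀ {i} → P i → Fin r → Fin M) →
    (∀ {i} (p : P i) → Injective _≡_ _≡_ (g p)) →
    (∀ {i j} (p : P i) (q : P j) s t → g p s ≡ g q t → i ≡ j) →
    count P? (allFin N) * r ≤ M
  count*≤ {r} {M} g g-injective g-separates = injective⇒≤ {f = f} f-injective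
    where
    c = count P? (allFin N)
    holds = witness-holds (allFin N)

    f : Fin (c * r) → Fin M
    f z = let j , t = remQuot {c} r z in g (holds j) t

    same-pair : ∀ j t j′ t′ → g (holds j) t ≡ g (holds j′) t′ → (j , t) ≡ (j′ , t′)
    same-pair j t j′ t′ eq with witness-injective (allFin N)
      (trans (sym (lookup-allFin _)) (trans (g-separates (holds j) (holds j′) t t′ eq) (lookup-allFin _)))
    -- Only once `j` and `j′` are identified do both sides use the same proof `holds j`, as
    -- `g-injective` requires.
    ... | refl = cong (j ,_) (g-injective (holds j) eq)

    f-injective : Injective _≡_ _≡_ f
    f-injective {y} {z} eq = trans (sym (combine-remQuot {c} r y))
      (trans (cong (uncurry combine) (same-pair _ _ _ _ eq)) (combine-remQuot {c} r z))

  -- The case of sets of size one: an index goes to the code of a chosen preimage under `d`, from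
  -- which `d` recovers it.
  count≤ : ∀ {c} {Code : Set c} → Fin M ↔ Code → (d : Code → Fin N) →
    (∀ {i} → P i → ∃ λ s → d s ≡ i) → count P? (allFin N) ≤ M
  count≤ {M} code d covered = subst (_≤ M) (*-identityʳ _)
    (count*≤ (λ p _ → Inverse.from code (proj₁ (covered p))) (λ { p {zero} {zero} _ → refl })
      λ p q _ _ eq → trans (sym (proj₂ (covered p)))
        (trans (cong d (Injection.injective (↔⇒↣ (↔-sym code)) eq)) (proj₂ (covered q))))

-- Flipped bits, decisions and images under permutations

flip-off : (x : Input N) {i p : Fin N} → p ≢ i → lookup (flip x i) p ≡ lookup x p
flip-off x {i} {p} p≢i = lookup∘updateAt′ p i p≢i x

does⇒ : ∀ {a} {A : Set a} (a? : Dec A) → does a? ≡ true → A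
does⇒ (yes a) _ = a

does-distinct : ∀ {a b} {A : Set a} {B : Set b} (a? : Dec A) (b? : Dec B) → A → ¬ B → does a? ≢ does b?
does-distinct a? b? yes-a no-b eq = no-b (does⇒ b? (trans (sym eq) (dec-true a? yes-a)))

∈-map-perm⁻ : (π : Permutation′ M) {B : Vec (Fin M) k} {b : Fin M} →
  b ∈ map (π ⟨$⟩ʳ_) B → π ⟨$⟩ˡ b ∈ B
∈-map-perm⁻ π {B} b∈πB = subst (_∈ B)
  (sym (trans (cong (π ⟨$⟩ˡ_) (trans (lookup-index b∈πB) (lookup-map (index b∈πB) _ B))) (inverseˡ π)))
  (∈-lookup (index b∈πB) B)

∉-map-perm⁻ : (π : Permutation′ M) {B : Vec (Fin M) k} {b : Fin M} →
  b ∉ map (π ⟨$⟩ʳ_) B → π ⟨$⟩ˡ b ∉ B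
∉-map-perm⁻ π {B} b∉πB π⁻b∈B = b∉πB (subst (_∈ map (π ⟨$⟩ʳ_) B) (inverseʳ π) (∈-map⁺ (π ⟨$⟩ʳ_) π⁻b∈B))

perm-injective : (π : Permutation′ M) → Injective _≡_ _≡_ (π ⟨$⟩ʳ_)
perm-injective π eq = trans (sym (inverseˡ π)) (trans (cong (π ⟨$⟩ˡ_) eq) (inverseˡ π))

-- The crossing matrix and conflicts between two lines

-- Every row of this matrix has three zeros and every column three ones.  So a row of one
-- pattern that is not a row of another is contradicted in three columns of the latter,
-- and dually.
half : Fin 6 → Bool
half u = does (toℕ u <? 3)

crossing : Fin 6 → Fin 6 → Bool
crossing u v = half u xor half v

-- The three indices whose `half` is the given bit.
block : Bool → Fin 3 → Fin 6
block true  = _↑ˡ 3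
block false = 3 ↑ʳ_

-- The ones of row `u` sit where `half v` differs from `half u`; they are the only exceptions to the
-- value 0 that the row has off `C`. In `col-values` the exceptions are dually the zeros. All 36
-- cases are evaluated.
row-values : ∀ u v → (∃ λ s → v ≡ block (not (half u)) s) ⊎ crossing u v ≡ false
row-values = toWitness
  {a? = all? λ u → all? λ v → any? (λ s → v ≟ block (not (half u)) s) ⊎-dec (crossing u v Bool.≟ false)} tt

col-values : ∀ v u → (∃ λ s → u ≡ block (half v) s) ⊎ crossing u v ≡ true
col-values = toWitness
  {a? = all? λ v → all? λ u → any? (λ s → u ≟ block (half v) s) ⊎-dec (crossing u v Bool.≟ true)} tt

crossing-0F : ∀ s → crossing 0F (3 ↑ʳ s) ≡ true
crossing-0F = toWitness {a? = all? λ s → crossing 0F (3 ↑ʳ s) Bool.≟ true} tt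

line-value : ∀ {β} {y : Fin M → Bool} {C : Vec (Fin M) k} {e : Fin l → Fin k} →
  (∀ {c} → c ∉ C → y c ≡ β) →
  (∀ v → (∃ λ s → v ≡ e s) ⊎ y (lookup C v) ≡ β) →
  ∀ {c} → (∀ s → c ≢ lookup C (e s)) → y c ≡ β
line-value {y = y} {C} y-off y-on {c} far with c ∈? C
... | no  c∉C = y-off c∉C
... | yes c∈C with y-on (index c∈C)
...   | inj₁ (s , eq) = contradiction (trans (lookup-index c∈C) (cong (lookup C) eq)) (far s)
...   | inj₂ eq       = trans (cong y (lookup-index c∈C)) eq

-- At most five of the six entries c of C′ are an exception of the line y (three)
-- or one of p and q; at any other one, y and z contradict each other.
lines-conflict : ∀ β {y z : Fin M → Bool} {C C′ : Vec (Fin M) 6} {e : Fin 3 → Fin 6} p q →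
  Unique C′ →
  (∀ {c} → c ∉ C → y c ≡ β) →
  (∀ v → (∃ λ s → v ≡ e s) ⊎ y (lookup C v) ≡ β) →
  (∀ {c} → c ∈ C′ → z c ≡ not β) →
  ¬ (∀ c → c ≢ p → c ≢ q → y c ≡ z c)
lines-conflict {M = M} β {y} {z} {C} {C′} {e} p q C′-unique y-off y-on z-on agree =
  let v , far = avoid {k = 5} {l = 6} (s≤s (s≤s (s≤s (s≤s (s≤s (s≤s z≤n))))))
        {g = lookup C′} (Unique.lookup-injective C′-unique _ _) exception
  in  not-¬ (line-value y-off y-on (λ s → far (suc (suc s))))
        (trans (agree _ (far 0F) (far 1F)) (z-on (∈-lookup v C′)))
  where
  exception : Fin 5 → Fin M
  exception 0F            = p
  exception 1F            = q
  exception (suc (suc s)) = lookup C (e s)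

-- Patterns and what it means to fit one

-- Hides how an index is split, so that the argument about patterns never meets tuples.
record Coordinates (M n N : ℕ) : Set where
  field
    cell       : (a b c : Fin M) (w : Fin n) → Fin N
    row        : Fin N → Fin M
    col        : Fin N → Fin M
    layer      : Fin N → Fin n
    row-cell   : ∀ a b c w → row (cell a b c w) ≡ b
    col-cell   : ∀ a b c w → col (cell a b c w) ≡ c
    layer-cell : ∀ a b c w → layer (cell a b c w) ≡ w

module Patterns {M n N} (coordinates : Coordinates M n N) (r : ℕ) where
  open Coordinates coordinates

  record Fits (a : Fin M) (B C : Vec (Fin M) 6) (W : Vec (Fin n) r) (x : Fin N → Bool) : Set where
    field
      rows-unique   : Unique B
      cols-unique   : Unique C
      layers-unique : Unique W
      on-rows       : ∀ b c w → b ∈ B → c ∉ C → w ∈ W → x (cell a b c w) ≡ false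
      on-cols       : ∀ b c w → b ∉ B → c ∈ C → w ∈ W → x (cell a b c w) ≡ true
      on-crossings  : ∀ u v w → w ∈ W → x (cell a (lookup B u) (lookup C v) w) ≡ crossing u v
      off-layers    : ∀ b c w → b ∈ B → c ∈ C → w ∉ W → x (cell a b c w) ≡ false

  open Fits

  fits? : ∀ a B C W x → Dec (Fits a B C W x)
  fits? a B C W x = map′
    (λ (p₁ , p₂ , p₃ , p₄ , p₅ , p₆ , p₇) → record
      { rows-unique = p₁ ; cols-unique = p₂ ; layers-unique = p₃
      ; on-rows = p₄ ; on-cols = p₅ ; on-crossings = p₆ ; off-layers = p₇ })
    (λ F → rows-unique F , cols-unique F , layers-unique F ,
           on-rows F , on-cols F , on-crossings F , off-layers F)
    (unique? B ×-dec unique? C ×-dec unique? W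
     ×-dec (all? λ b → all? λ c → all? λ w →
              b ∈? B →-dec ¬? (c ∈? C) →-dec w ∈? W →-dec _ Bool.≟ _)
     ×-dec (all? λ b → all? λ c → all? λ w →
              ¬? (b ∈? B) →-dec c ∈? C →-dec w ∈? W →-dec _ Bool.≟ _)
     ×-dec (all? λ u → all? λ v → all? λ w → w ∈? W →-dec _ Bool.≟ _)
     ×-dec (all? λ b → all? λ c → all? λ w →
              b ∈? B →-dec c ∈? C →-dec ¬? (w ∈? W) →-dec _ Bool.≟ _))
    where
    unique? : ∀ {K k} (xs : Vec (Fin K) k) → Dec (Unique xs)
    unique? = allPairs? λ i j → ¬? (i ≟ j)

  Accepts : (Fin N → Bool) → Set
  Accepts x = ∃ λ a → ∃ λ B → ∃ λ C → ∃ λ W → Fits a B C W x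

  accepts? : Decidable Accepts
  accepts? x = any? λ a → anyVec? 6 λ B → anyVec? 6 λ C → anyVec? r λ W → fits? a B C W x

  fits-cong : ∀ {a B C W x y} → x ≗ y → Fits a B C W x → Fits a B C W y
  fits-cong x≗y F = record
    { rows-unique   = rows-unique F
    ; cols-unique   = cols-unique F
    ; layers-unique = layers-unique F
    ; on-rows       = λ b c w p q s → trans (sym (x≗y _)) (on-rows F b c w p q s)
    ; on-cols       = λ b c w p q s → trans (sym (x≗y _)) (on-cols F b c w p q s)
    ; on-crossings  = λ u v w p → trans (sym (x≗y _)) (on-crossings F u v w p)
    ; off-layers    = λ b c w p q s → trans (sym (x≗y _)) (off-layers F b c w p q s)
    }

  -- At each prescribed cell `y` and `z` carry the same bit. This is meant for two different flips
  -- of one input `x`: everywhere `x` agrees with at least one of them.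
  fits-mix : ∀ {a B C W x y z} → (∀ p → x p ≡ y p ⊎ x p ≡ z p) →
    Fits a B C W y → Fits a B C W z → Fits a B C W x
  fits-mix {x = x} {y} {z} mix F G = record
    { rows-unique   = rows-unique F
    ; cols-unique   = cols-unique F
    ; layers-unique = layers-unique F
    ; on-rows       = λ b c w p q s → choose (on-rows F b c w p q s) (on-rows G b c w p q s)
    ; on-cols       = λ b c w p q s → choose (on-cols F b c w p q s) (on-cols G b c w p q s)
    ; on-crossings  = λ u v w p → choose (on-crossings F u v w p) (on-crossings G u v w p)
    ; off-layers    = λ b c w p q s → choose (off-layers F b c w p q s) (off-layers G b c w p q s)
    }
    where
    choose : ∀ {p β} → y p ≡ β → z p ≡ β → x p ≡ β
    choose {p} y≡β z≡β with mix p
    ... | inj₁ x≡y = trans x≡y y≡β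
    ... | inj₂ x≡z = trans x≡z z≡β

  -- Patterns with the same slice and a common layer

  AgreeOff : Fin N → Fin N → (y z : Fin N → Bool) → Set
  AgreeOff i j y z = ∀ p → p ≢ i → p ≢ j → y p ≡ z p

  module _ {a i j B C W B′ C′ W′ y z} (F : Fits a B C W y) (G : Fits a B′ C′ W′ z)
           (agree : AgreeOff i j y z) {w} (w∈W : w ∈ W) (w∈W′ : w ∈ W′) where

    -- If `b` were not in `B′`, then along row `b` in layer `w` the input `y` would be 0 up to three
    -- columns, while `z` would be 1 on all six columns of `C′`; `i` and `j` account for at most one
    -- column each.
    rows⊆ : ∀ {b} → b ∈ B → b ∈ B′
    rows⊆ {b} b∈B with b ∈? B′
    ... | yes b∈B′ = b∈B′
    ... | no  b∉B′ = contradiction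
      (λ c c≢i c≢j → agree (cell a b c w) (λ { refl → c≢i (sym (col-cell a b c w)) })
                                          (λ { refl → c≢j (sym (col-cell a b c w)) }))
      (lines-conflict false (col i) (col j) (cols-unique G)
        (λ c∉C → on-rows F b _ w b∈B c∉C w∈W)
        values
        (λ c∈C′ → on-cols G b _ w b∉B′ c∈C′ w∈W′))
      where
      u = index b∈B
      values : ∀ v → (∃ λ s → v ≡ block (not (half u)) s) ⊎ y (cell a b (lookup C v) w) ≡ false
      values v with row-values u v
      ... | inj₁ hit = inj₁ hit
      ... | inj₂ eq  = inj₂ (trans (cong (λ b → y (cell a b (lookup C v) w)) (lookup-index b∈B))
                                   (trans (on-crossings F u v w w∈W) eq))

    -- Dual to `rows⊆`: along column `c`, `y` is 1 up to three rows and `z` would be 0 on the six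
    -- rows of `B′`.
    cols⊆ : ∀ {c} → c ∈ C → c ∈ C′
    cols⊆ {c} c∈C with c ∈? C′
    ... | yes c∈C′ = c∈C′
    ... | no  c∉C′ = contradiction
      (λ b b≢i b≢j → agree (cell a b c w) (λ { refl → b≢i (sym (row-cell a b c w)) })
                                          (λ { refl → b≢j (sym (row-cell a b c w)) }))
      (lines-conflict true (row i) (row j) (rows-unique G)
        (λ b∉B → on-cols F _ c w b∉B c∈C w∈W)
        values
        (λ b∈B′ → on-rows G _ c w b∈B′ c∉C′ w∈W′))
      where
      v = index c∈C
      values : ∀ u → (∃ λ s → u ≡ block (half v) s) ⊎ y (cell a (lookup B u) c w) ≡ true
      values u with col-values v u
      ... | inj₁ hit = inj₁ hit
      ... | inj₂ eq  = inj₂ (trans (cong (λ c → y (cell a (lookup B u) c w)) (lookup-index c∈C))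
                                   (trans (on-crossings F u v w w∈W) eq))

    -- By the two inclusions above, crossings of the first pattern are crossings of the second. If
    -- `w′` were not in `W′`, all of them would be 0 in `z`, but the first row has three ones in
    -- `y`, and one lies outside the columns of `i` and `j`.
    layers⊆ : ∀ {w′} → w′ ∈ W → w′ ∈ W′
    layers⊆ {w′} w′∈W with w′ ∈? W′
    ... | yes w′∈W′ = w′∈W′
    ... | no  w′∉W′ = contradiction
      (trans (sym (off-layers G b c w′ (rows⊆ (∈-lookup 0F B)) (cols⊆ (∈-lookup v C)) w′∉W′))
        (trans (sym (agree _ (λ eq → far 0F (trans (sym (col-cell a b c w′)) (cong col eq)))
                             (λ eq → far 1F (trans (sym (col-cell a b c w′)) (cong col eq)))))
          (trans (on-crossings F 0F v w′ w′∈W) (crossing-0F s))))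
      λ ()
      where
      bad : Fin 2 → Fin M
      bad 0F = col i
      bad 1F = col j
      far-index = avoid {k = 2} {l = 3} (s≤s (s≤s (s≤s z≤n)))
        {g = λ s → lookup C (3 ↑ʳ s)}
        (λ eq → ↑ʳ-injective 3 _ _ (Unique.lookup-injective (cols-unique F) _ _ eq)) bad
      s = proj₁ far-index
      far = proj₂ far-index
      v = 3 ↑ʳ s
      b = lookup B 0F
      c = lookup C v

    -- The same matrix is repeated in every layer of `W`, so it can be compared in a layer that
    -- contains neither `i` nor `j`; three layers guarantee one.
    crossings-agree : 3 ≤ r → ∀ {u v u′ v′} →
      lookup B u ≡ lookup B′ u′ → lookup C v ≡ lookup C′ v′ → crossing u v ≡ crossing u′ v′
    crossings-agree 3≤r {u} {v} {u′} {v′} eqB eqC =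
      trans (sym (on-crossings F u v w′ (∈-lookup t W)))
        (trans (agree _ (λ eq → far 0F (trans (sym (layer-cell _ _ _ w′)) (cong layer eq)))
                        (λ eq → far 1F (trans (sym (layer-cell _ _ _ w′)) (cong layer eq))))
          (trans (cong₂ (λ b c → z (cell a b c w′)) eqB eqC)
            (on-crossings G u′ v′ w′ (layers⊆ (∈-lookup t W)))))
      where
      bad : Fin 2 → Fin n
      bad 0F = layer i
      bad 1F = layer j
      far-index = avoid 3≤r {g = lookup W} (Unique.lookup-injective (layers-unique F) _ _) bad
      t = proj₁ far-index
      far = proj₂ far-index
      w′ = lookup W t

  -- The inclusions hold in both directions, so the two patterns have the same rows, columns and
  -- layers. The vectors may list them in different orders; `crossings-agree` shows that the
  -- prescribed matrix is still the same.
  fits-same : 3 ≤ r → ∀ {a i j B C W B′ C′ W′ y z w} → AgreeOff i j y z → w ∈ W → w ∈ W′ →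
    Fits a B C W y → Fits a B′ C′ W′ z → Fits a B C W z
  fits-same 3≤r {a} {i} {j} {B} {C} {y = y} {z} agree w∈W w∈W′ F G = record
    { rows-unique   = rows-unique F
    ; cols-unique   = cols-unique F
    ; layers-unique = layers-unique F
    ; on-rows       = λ b c w p q s → on-rows G b c w (rows⊆ F G agree w∈W w∈W′ p)
                        (q ∘ cols⊆ G F agree′ w∈W′ w∈W) (layers⊆ F G agree w∈W w∈W′ s)
    ; on-cols       = λ b c w p q s → on-cols G b c w (p ∘ rows⊆ G F agree′ w∈W′ w∈W)
                        (cols⊆ F G agree w∈W w∈W′ q) (layers⊆ F G agree w∈W w∈W′ s)
    ; on-crossings  = λ u v w s →
        let b∈B′ = rows⊆ F G agree w∈W w∈W′ (∈-lookup u B)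
            c∈C′ = cols⊆ F G agree w∈W w∈W′ (∈-lookup v C)
        in  trans (cong₂ (λ b c → z (cell a b c w)) (lookup-index b∈B′) (lookup-index c∈C′))
              (trans (on-crossings G (index b∈B′) (index c∈C′) w (layers⊆ F G agree w∈W w∈W′ s))
                (sym (crossings-agree F G agree w∈W w∈W′ 3≤r (lookup-index b∈B′) (lookup-index c∈C′))))
    ; off-layers    = λ b c w p q s → off-layers G b c w (rows⊆ F G agree w∈W w∈W′ p)
                        (cols⊆ F G agree w∈W w∈W′ q) (s ∘ layers⊆ G F agree′ w∈W′ w∈W)
    }
    where
    agree′ : AgreeOff i j z y
    agree′ p p≢i p≢j = sym (agree p p≢i p≢j)
-- x

  patternFunction : BooleanFunction N
  patternFunction x = does (accepts? (lookup x))

  patternFunction-equal : ∀ x y → (Accepts (lookup x) → Accepts (lookup y)) →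
    (Accepts (lookup y) → Accepts (lookup x)) → patternFunction x ≡ patternFunction y
  patternFunction-equal x y to from = does-⇔ (mk⇔ to from) (accepts? (lookup x)) (accepts? (lookup y))

  accepts-cong : ∀ {x y} → x ≗ y → Accepts x → Accepts y
  accepts-cong x≗y (_ , _ , _ , _ , F) = _ , _ , _ , _ , fits-cong x≗y F

  module _ (τ : Fin N → Fin N) (α β γ : Permutation′ M) (ω : Permutation′ n)
           (τ-cell : ∀ a b c w → τ (cell a b c w) ≡
              cell (α ⟨$⟩ʳ a) (β ⟨$⟩ʳ b) (γ ⟨$⟩ʳ c) (ω ⟨$⟩ʳ w)) where

    fits-permuted : ∀ {a B C W x} → Fits a B C W (x ∘ τ) →
      Fits (α ⟨$⟩ʳ a) (map (β ⟨$⟩ʳ_) B) (map (γ ⟨$⟩ʳ_) C) (map (ω ⟨$⟩ʳ_) W) x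
    fits-permuted {a} {B} {C} {W} {x} F = record
      { rows-unique   = Unique.map⁺ (perm-injective β) (rows-unique F)
      ; cols-unique   = Unique.map⁺ (perm-injective γ) (cols-unique F)
      ; layers-unique = Unique.map⁺ (perm-injective ω) (layers-unique F)
      ; on-rows       = λ b c w p q s → trans (pull-back b c w)
          (on-rows F _ _ _ (∈-map-perm⁻ β p) (∉-map-perm⁻ γ q) (∈-map-perm⁻ ω s))
      ; on-cols       = λ b c w p q s → trans (pull-back b c w)
          (on-cols F _ _ _ (∉-map-perm⁻ β p) (∈-map-perm⁻ γ q) (∈-map-perm⁻ ω s))
      ; on-crossings  = λ u v w s → trans
          (trans (cong₂ (λ b c → x (cell _ b c w)) (lookup-map u _ B) (lookup-map v _ C))
            (trans (pull-back _ _ w)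
              (cong₂ (λ b c → x (τ (cell a b c (ω ⟨$⟩ˡ w)))) (inverseˡ β) (inverseˡ γ))))
          (on-crossings F u v _ (∈-map-perm⁻ ω s))
      ; off-layers    = λ b c w p q s → trans (pull-back b c w)
          (off-layers F _ _ _ (∈-map-perm⁻ β p) (∈-map-perm⁻ γ q) (∉-map-perm⁻ ω s))
      }
      where
      -- Every cell of the moved slice is the `τ`-image of the cell with the inverse coordinates,
      -- where the fit of `x ∘ τ` applies.
      pull-back : ∀ b c w → x (cell (α ⟨$⟩ʳ a) b c w) ≡
        x (τ (cell a (β ⟨$⟩ˡ b) (γ ⟨$⟩ˡ c) (ω ⟨$⟩ˡ w)))
      pull-back b c w = cong x (sym (trans (τ-cell _ _ _ _)
        (trans (cong₂ (λ b c → cell _ b c _) (inverseʳ β) (inverseʳ γ)) (cong (cell _ b c) (inverseʳ ω)))))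

    accepts-permuted : ∀ {x} → Accepts (x ∘ τ) → Accepts x
    accepts-permuted (_ , _ , _ , _ , F) = _ , _ , _ , _ , fits-permuted F

  module _ {a : Fin M} {B C : Vec (Fin M) 6} {W : Vec (Fin n) r}
           (B-unique : Unique B) (C-unique : Unique C) (W-unique : Unique W) where

    -- One rule for every cell: rows outside `B` are 1 and rows in `B` are 0 off the crossings, in
    -- all layers. The decisions are arguments so that the clauses below can split on them.
    value : ∀ {b c w} → Dec (b ∈ B) → Dec (c ∈ C) → Dec (w ∈ W) → Bool
    value (yes b∈B) (yes c∈C) (yes _) = crossing (index b∈B) (index c∈C)
    value (yes _)   (yes _)   (no _)  = false
    value (yes _)   (no _)    _       = false
    value (no _)    _         _       = true

    fitting : Fin N → Bool
    fitting p = value (row p ∈? B) (col p ∈? C) (layer p ∈? W)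

    fitting-cell : ∀ b c w → fitting (cell a b c w) ≡ value (b ∈? B) (c ∈? C) (w ∈? W)
    fitting-cell b c w rewrite row-cell a b c w | col-cell a b c w | layer-cell a b c w = refl

    fitting-fits : Fits a B C W fitting
    fitting-fits = record
      { rows-unique   = B-unique
      ; cols-unique   = C-unique
      ; layers-unique = W-unique
      ; on-rows       = λ b c w p q _ → trans (fitting-cell b c w) (rows-value (b ∈? B) (c ∈? C) (w ∈? W) p q)
      ; on-cols       = λ b c w p _ _ → trans (fitting-cell b c w) (cols-value (b ∈? B) (c ∈? C) (w ∈? W) p)
      ; on-crossings  = λ u v w s → trans (fitting-cell _ _ w)
          (crossings-value u v (lookup B u ∈? B) (lookup C v ∈? C) (w ∈? W) s)
      ; off-layers    = λ b c w p q s → trans (fitting-cell b c w)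
          (layers-value (b ∈? B) (c ∈? C) (w ∈? W) p q s)
      }
      where
      rows-value : ∀ {b c w} (b? : Dec (b ∈ B)) (c? : Dec (c ∈ C)) (w? : Dec (w ∈ W)) →
        b ∈ B → c ∉ C → value b? c? w? ≡ false
      rows-value (no b∉B) _         _ b∈B _   = contradiction b∈B b∉B
      rows-value (yes _)  (yes c∈C) _ _   c∉C = contradiction c∈C c∉C
      rows-value (yes _)  (no _)    _ _   _   = refl

      cols-value : ∀ {b c w} (b? : Dec (b ∈ B)) (c? : Dec (c ∈ C)) (w? : Dec (w ∈ W)) →
        b ∉ B → value b? c? w? ≡ true
      cols-value (no _)    _ _ _   = refl
      cols-value (yes b∈B) _ _ b∉B = contradiction b∈B b∉B

      crossings-value : ∀ u v {w}
        (b? : Dec (lookup B u ∈ B)) (c? : Dec (lookup C v ∈ C)) (w? : Dec (w ∈ W)) →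
        w ∈ W → value b? c? w? ≡ crossing u v
      crossings-value u v (yes b∈B) (yes c∈C) (yes _) _ = cong₂ crossing
        (sym (Unique.lookup-injective B-unique _ _ (lookup-index b∈B)))
        (sym (Unique.lookup-injective C-unique _ _ (lookup-index c∈C)))
      crossings-value u v (no b∉B) _        _        _   = contradiction (∈-lookup u B) b∉B
      crossings-value u v (yes _)  (no c∉C) _        _   = contradiction (∈-lookup v C) c∉C
      crossings-value u v (yes _)  (yes _)  (no w∉W) w∈W = contradiction w∈W w∉W

      layers-value : ∀ {b c w} (b? : Dec (b ∈ B)) (c? : Dec (c ∈ C)) (w? : Dec (w ∈ W)) →
        b ∈ B → c ∈ C → w ∉ W → value b? c? w? ≡ false
      layers-value (yes _)  (yes _)  (no _)    _   _   _   = refl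
      layers-value (yes _)  (yes _)  (yes w∈W) _   _   w∉W = contradiction w∈W w∉W
      layers-value (yes _)  (no c∉C) _         _   c∈C _   = contradiction c∈C c∉C
      layers-value (no b∉B) _        _         b∈B _   _   = contradiction b∈B b∉B

  accepts-fitting : 0 < M → 6 ≤ M → r ≤ n → ∃ Accepts
  accepts-fitting (s≤s _) 6≤M r≤n = _ , zero , _ , _ , _ ,
    fitting-fits (initial 6≤M) (initial 6≤M) (initial r≤n)
    where
    initial : (k≤l : k ≤ l) → Unique (tabulate λ u → inject≤ u k≤l)
    initial k≤l = Unique.tabulate⁺ λ eq → inject≤-injective k≤l k≤l _ _ eq

  -- Every pattern with at least one layer prescribes a one among its crossings.
  ¬accepts-false : Fin r → ¬ Accepts (λ _ → false)
  ¬accepts-false t (_ , _ , _ , W , F) =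
    contradiction (on-crossings F 0F (3 ↑ʳ 0F) _ (∈-lookup t W)) λ ()

  patternFunction-nonConstant : 0 < r → r ≤ n → 6 ≤ M → NonConstant patternFunction
  patternFunction-nonConstant 0<r r≤n 6≤M =
    let y , y-accepted = accepts-fitting (≤-trans (s≤s z≤n) 6≤M) 6≤M r≤n
    in  tabulate y , tabulate (λ _ → false) ,
        does-distinct (accepts? (lookup (tabulate y))) (accepts? (lookup (tabulate λ _ → false)))
          (accepts-cong (sym ∘ lookup∘tabulate y) y-accepted)
          (¬accepts-false (fromℕ< 0<r) ∘ accepts-cong (lookup∘tabulate λ _ → false))

  -- Sensitivity at accepted inputs

  module _ (a : Fin M) (B C : Vec (Fin M) 6) (W : Vec (Fin n) r) where

    -- Codes for the prescribed cells: rows in layers of `W`, columns in layers of `W`, crossings in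
    -- all layers. Cells may have several codes, which is harmless for an upper bound.
    Support : Set
    Support = ((Fin 6 × Fin M) × Fin r ⊎ (Fin 6 × Fin M) × Fin r) ⊎ (Fin 6 × Fin 6) × Fin n

    support : Support → Fin N
    support (inj₁ (inj₁ ((u , c) , t))) = cell a (lookup B u) c (lookup W t)
    support (inj₁ (inj₂ ((v , b) , t))) = cell a b (lookup C v) (lookup W t)
    support (inj₂ ((u , v) , w))        = cell a (lookup B u) (lookup C v) w

    triples : ∀ {p q s} → Fin (p * q * s) ↔ ((Fin p × Fin q) × Fin s)
    triples = ↔-trans *↔× (*↔× ×-↔ ↔-refl)

    supportSize : ℕ
    supportSize = (6 * M * r + 6 * M * r) + 6 * 6 * n

    support-code : Fin supportSize ↔ Support
    support-code = ↔-trans +↔⊎ (↔-trans +↔⊎ (triples ⊎-↔ triples) ⊎-↔ triples)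

    fits-support : ∀ {x y} → (∀ s → y (support s) ≡ x (support s)) → Fits a B C W x → Fits a B C W y
    fits-support {x} {y} eq F = record
      { rows-unique   = rows-unique F
      ; cols-unique   = cols-unique F
      ; layers-unique = layers-unique F
      ; on-rows       = λ b c w p q s → trans (row-eq p s) (on-rows F b c w p q s)
      ; on-cols       = λ b c w p q s → trans (col-eq q s) (on-cols F b c w p q s)
      ; on-crossings  = λ u v w s → trans (eq (inj₂ ((u , v) , w))) (on-crossings F u v w s)
      ; off-layers    = λ b c w p q s → trans (crossing-eq p q) (off-layers F b c w p q s)
      }
      where
      row-eq : ∀ {b c w} → b ∈ B → w ∈ W → y (cell a b c w) ≡ x (cell a b c w)
      row-eq {c = c} p s = subst (λ q → y q ≡ x q)
        (sym (cong₂ (λ b w → cell a b c w) (lookup-index p) (lookup-index s)))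
        (eq (inj₁ (inj₁ ((index p , c) , index s))))
      col-eq : ∀ {b c w} → c ∈ C → w ∈ W → y (cell a b c w) ≡ x (cell a b c w)
      col-eq {b} q s = subst (λ q → y q ≡ x q)
        (sym (cong₂ (λ c w → cell a b c w) (lookup-index q) (lookup-index s)))
        (eq (inj₁ (inj₂ ((index q , b) , index s))))
      crossing-eq : ∀ {b c w} → b ∈ B → c ∈ C → y (cell a b c w) ≡ x (cell a b c w)
      crossing-eq {w = w} p q = subst (λ q → y q ≡ x q)
        (sym (cong₂ (λ b c → cell a b c w) (lookup-index p) (lookup-index q)))
        (eq (inj₂ ((index p , index q) , w)))

  -- A flip outside the support leaves the pattern fitted and the value true, so every sensitive bit
  -- lies in the support.
  fits-bound : ∀ x {a B C W} → patternFunction x ≡ true → Fits a B C W (lookup x) →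
    sensitivityAt patternFunction x ≤ (6 * M * r + 6 * M * r) + 6 * 6 * n
  fits-bound x {a} {B} {C} {W} fx≡true F =
    count≤ (λ i → ¬? (patternFunction x Bool.≟ patternFunction (flip x i))) code d supported
    where
    code = support-code a B C W
    d = support a B C W

    unsupported : ∀ {i} → ¬ (∃ λ z → d (Inverse.to code z) ≡ i) → Accepts (lookup (flip x i))
    unsupported ¬hit = a , B , C , W , fits-support a B C W
      (λ s → flip-off x (λ eq → ¬hit (Inverse.from code s , trans (cong d (Inverse.strictlyInverseˡ code s)) eq))) F

    supported : ∀ {i} → patternFunction x ≢ patternFunction (flip x i) → ∃ λ s → d s ≡ i
    -- Searching the finite set of codes makes the claim decidable, so it may be proved by
    -- contradiction.
    supported {i} sensitive = fromIndex (decidable-stable (any? λ z → d (Inverse.to code z) ≟ i) λ ¬hit →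
      sensitive (trans fx≡true (sym (dec-true (accepts? (lookup (flip x i))) (unsupported ¬hit)))))
      where
      fromIndex : (∃ λ z → d (Inverse.to code z) ≡ i) → ∃ λ s → d s ≡ i
      fromIndex (z , eq) = Inverse.to code z , eq

  sensitivityAt-true : ∀ x → patternFunction x ≡ true →
    sensitivityAt patternFunction x ≤ (6 * M * r + 6 * M * r) + 6 * 6 * n
  sensitivityAt-true x fx≡true =
    let _ , _ , _ , _ , F = does⇒ (accepts? (lookup x)) fx≡true in fits-bound x fx≡true F

  -- Sensitivity at rejected inputs

  location : ∀ {y} → Accepts y → Fin r → Fin (M * n)
  location (a , _ , _ , W , _) t = combine a (lookup W t)

  location-injective : ∀ {y} (acc : Accepts y) → Injective _≡_ _≡_ (location acc)
  location-injective (a , _ , _ , W , F) eq =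
    Unique.lookup-injective (layers-unique F) _ _ (combine-injectiveʳ a _ a _ eq)

  -- A shared location means the same slice and a common layer. If `i ≢ j`, then by `fits-same` both
  -- flips fit the first pattern, and by `fits-mix` so does `x`, which is rejected.
  location-separates : 3 ≤ r → ∀ x {i j} → ¬ Accepts (lookup x) →
    (acc : Accepts (lookup (flip x i))) (acc′ : Accepts (lookup (flip x j))) →
    ∀ s t → location acc s ≡ location acc′ t → i ≡ j
  location-separates 3≤r x {i} {j} ¬accepts (a , B , C , W , F) (a′ , B′ , C′ , W′ , F′) s t eq
    with i ≟ j | combine-injectiveˡ a (lookup W s) a′ (lookup W′ t) eq
       | combine-injectiveʳ a (lookup W s) a′ (lookup W′ t) eq
  ... | yes i≡j | _    | _   = i≡j
  ... | no  i≢j | refl | eqW = contradiction (a , B , C , W , fits-mix mix F F″) ¬accepts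
    where
    agree : AgreeOff i j (lookup (flip x i)) (lookup (flip x j))
    agree p p≢i p≢j = trans (flip-off x p≢i) (sym (flip-off x p≢j))

    F″ : Fits a B C W (lookup (flip x j))
    F″ = fits-same 3≤r agree (∈-lookup s W) (subst (_∈ W′) (sym eqW) (∈-lookup t W′)) F F′

    mix : ∀ p → lookup x p ≡ lookup (flip x i) p ⊎ lookup x p ≡ lookup (flip x j) p
    mix p with p ≟ i
    ... | no  p≢i  = inj₁ (sym (flip-off x p≢i))
    ... | yes refl = inj₂ (sym (flip-off x i≢j))

  sensitivityAt-false : 3 ≤ r → ∀ x → patternFunction x ≡ false →
    sensitivityAt patternFunction x * r ≤ M * n
  sensitivityAt-false 3≤r x fx≡false =
    count*≤ (λ i → ¬? (patternFunction x Bool.≟ patternFunction (flip x i)))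
      (λ p → location (accepted p))
      (λ p → location-injective (accepted p))
      (λ p q → location-separates 3≤r x ¬accepts (accepted p) (accepted q))
    where
    ¬accepts : ¬ Accepts (lookup x)
    ¬accepts acc = contradiction (trans (sym fx≡false) (dec-true (accepts? (lookup x)) acc)) λ ()

    accepted : ∀ {i} → patternFunction x ≢ patternFunction (flip x i) → Accepts (lookup (flip x i))
    accepted {i} sensitive = does⇒ (accepts? (lookup (flip x i)))
      (trans (¬-not (sensitive ∘ sym)) (cong not fx≡false))

open Patterns using
  (Accepts; accepts-cong; accepts-permuted; patternFunction; patternFunction-equal;
   patternFunction-nonConstant; sensitivityAt-true; sensitivityAt-false)

-- Splitting k-tuples into slice, row, column and layer

sensitivity≤ : ∀ {b} (f : BooleanFunction N) → (∀ x → sensitivityAt f x ≤ b) → sensitivity f ≤ b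
sensitivity≤ f bound = max≤v⁺ z≤n (All.map⁺ (universal bound (allInputs _)))

funToFin-cong : {f g : Fin k → Fin n} → f ≗ g → funToFin f ≡ funToFin g
funToFin-cong {zero}  f≗g = refl
funToFin-cong {suc k} f≗g = cong₂ combine (f≗g zero) (funToFin-cong (f≗g ∘ suc))

act : (Fin k → Fin n → Fin n) → Fin (n ^ k) → Fin (n ^ k)
act {k} {n} h p = funToFin λ l → h l (finToFun {n} {k} p l)

act-inverse : (g h : Fin k → Fin n → Fin n) → (∀ l i → g l (h l i) ≡ i) → ∀ p → act g (act h p) ≡ p
act-inverse {k} {n} g h inverse p = trans
  (funToFin-cong λ l → trans (cong (g l) (finToFun-funToFin (λ l → h l (finToFun {n} {k} p l)) l)) (inverse l _))
  (funToFin-finToFin {k} {n} p)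

-- `relabel σ x` is `x` composed with this permutation of the positions.
tuplePermutation : (Fin k → Permutation′ n) → Permutation′ (n ^ k)
tuplePermutation σ = permutation
  (act λ l → σ l ⟨$⟩ʳ_) (act λ l → σ l ⟨$⟩ˡ_)
  (act-inverse (λ l → σ l ⟨$⟩ʳ_) (λ l → σ l ⟨$⟩ˡ_) λ l i → inverseʳ (σ l))
  (act-inverse (λ l → σ l ⟨$⟩ˡ_) (λ l → σ l ⟨$⟩ʳ_) λ l i → inverseˡ (σ l))

module _ {m n : ℕ} where

  part : (a b c : Fin (n ^ m)) → Fin 3 → Fin (n ^ m)
  part a b c 0F = a
  part a b c 1F = b
  part a b c 2F = c

  -- Entry 0 of a k-tuple is w; the other 3m entries form an m × 3 table with columns a, b, c.
  tuple : (a b c : Fin (n ^ m)) (w : Fin n) → Fin (1 + m * 3) → Fin n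
  tuple a b c w zero    = w
  tuple a b c w (suc q) = let l , s = remQuot {m} 3 q in finToFun {n} {m} (part a b c s) l

  position : (a b c : Fin (n ^ m)) (w : Fin n) → Fin (n ^ (1 + m * 3))
  position a b c w = funToFin (tuple a b c w)

  partOf : Fin 3 → Fin (n ^ (1 + m * 3)) → Fin (n ^ m)
  partOf s p = funToFin λ l → finToFun {n} {1 + m * 3} p (suc (combine {m} {3} l s))

  partOf-position : ∀ s a b c w → partOf s (position a b c w) ≡ part a b c s
  partOf-position s a b c w = trans
    (funToFin-cong λ l → trans (finToFun-funToFin (tuple a b c w) (suc (combine {m} {3} l s)))
      (cong (λ (l , s) → finToFun {n} {m} (part a b c s) l) (remQuot-combine {m} {3} l s)))
    (funToFin-finToFin {m} {n} (part a b c s))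

  coordinates : Coordinates (n ^ m) n (n ^ (1 + m * 3))
  coordinates = record
    { cell       = position
    ; row        = partOf 1F
    ; col        = partOf 2F
    ; layer      = λ p → finToFun {n} {1 + m * 3} p zero
    ; row-cell   = partOf-position 1F
    ; col-cell   = partOf-position 2F
    ; layer-cell = λ a b c w → finToFun-funToFin (tuple a b c w) zero
    }

  module _ (σ : Fin (1 + m * 3) → Permutation′ n) where

    partPermutation : Fin 3 → Permutation′ (n ^ m)
    partPermutation s = tuplePermutation λ l → σ (suc (combine {m} {3} l s))

    -- Provides `τ-cell`: each of the three parts is moved only by the entries of `σ` at its own
    -- places in the tuple, and the layer only by `σ zero`.
    position-permuted : ∀ a b c w → tuplePermutation σ ⟨$⟩ʳ position a b c w ≡
      position (partPermutation 0F ⟨$⟩ʳ a) (partPermutation 1F ⟨$⟩ʳ b)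
               (partPermutation 2F ⟨$⟩ʳ c) (σ zero ⟨$⟩ʳ w)
    position-permuted a b c w = funToFin-cong λ i →
      trans (cong (σ i ⟨$⟩ʳ_) (finToFun-funToFin (tuple a b c w) i)) (pointwise i)
      where
      a′ = partPermutation 0F ⟨$⟩ʳ a
      b′ = partPermutation 1F ⟨$⟩ʳ b
      c′ = partPermutation 2F ⟨$⟩ʳ c

      part-permuted : ∀ s → part a′ b′ c′ s ≡ partPermutation s ⟨$⟩ʳ part a b c s
      part-permuted 0F = refl
      part-permuted 1F = refl
      part-permuted 2F = refl

      pointwise : ∀ i → σ i ⟨$⟩ʳ tuple a b c w i ≡ tuple a′ b′ c′ (σ zero ⟨$⟩ʳ w) i
      pointwise zero    = refl
      pointwise (suc q) = let l , s = remQuot {m} 3 q in sym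
        (trans (cong (λ p → finToFun {n} {m} p l) (part-permuted s))
          (trans (finToFun-funToFin {m} {n} (λ l → σ (suc (combine {m} {3} l s)) ⟨$⟩ʳ finToFun {n} {m} (part a b c s) l) l)
            (cong (λ q′ → σ (suc q′) ⟨$⟩ʳ finToFun {n} {m} (part a b c s) l) (combine-remQuot {m} 3 q))))

  module _ (r : ℕ) where

    pattern-isProperty : IsHypergraphProperty (1 + m * 3) n (patternFunction coordinates r)
    pattern-isProperty x σ = patternFunction-equal coordinates r x (relabel σ x)
      -- `permuted` gives only one implication; the other follows by applying it to the inverse
      -- permutations.
      (λ acc → permuted (λ l → ↔-sym (σ l))
        (accepts-cong coordinates r (λ p → sym (trans (relabelled _)
          (cong (lookup x) (inverseʳ (tuplePermutation σ) {p})))) acc))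
      (λ acc → permuted σ (accepts-cong coordinates r relabelled acc))
      where
      relabelled : ∀ p → lookup (relabel σ x) p ≡ lookup x (tuplePermutation σ ⟨$⟩ʳ p)
      relabelled = lookup∘tabulate (λ p → lookup x (tuplePermutation σ ⟨$⟩ʳ p))

      permuted : ∀ ρ {y} → Accepts coordinates r (λ p → y (tuplePermutation ρ ⟨$⟩ʳ p)) →
        Accepts coordinates r y
      permuted ρ = accepts-permuted coordinates r (tuplePermutation ρ ⟨$⟩ʳ_)
        (partPermutation ρ 0F) (partPermutation ρ 1F) (partPermutation ρ 2F) (ρ zero)
        (position-permuted ρ)

-- The combined sensitivity bound and the integer square root

-- Taking `r` of order √n balances the two bounds: `12 * M * r + 36 * n` at accepted inputs and
-- `M * n / r` at rejected ones are both of order `M * r`. The factor 48 is 6 + 6 + 36.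
pattern-sensitivity : (c : Coordinates M n N) → 3 ≤ r → n ≤ M → n ≤ 4 * (r * r) →
  sensitivity (patternFunction c r) ≤ 48 * (M * r)
pattern-sensitivity {M} {n} {r = r@(suc _)} c 3≤r n≤M n≤4r² = sensitivity≤ f bound
  where
  open ≤-Reasoning
  f = patternFunction c r

  bound-true : ∀ x → f x ≡ true → sensitivityAt f x ≤ 48 * (M * r)
  bound-true x fx = begin
    sensitivityAt f x                             ≤⟨ sensitivityAt-true c r x fx ⟩
    (6 * M * r + 6 * M * r) + 6 * 6 * n           ≤⟨ +-monoʳ-≤ (6 * M * r + 6 * M * r)
                                                       (*-monoʳ-≤ 36 (≤-trans n≤M (m≤m*n M r))) ⟩
    (6 * M * r + 6 * M * r) + 6 * 6 * (M * r)     ≡⟨ identity M r ⟩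
    48 * (M * r)                                  ∎
    where
    identity : ∀ M r → (6 * M * r + 6 * M * r) + 6 * 6 * (M * r) ≡ 48 * (M * r)
    identity = solve-∀

  bound-false : ∀ x → f x ≡ false → sensitivityAt f x ≤ 48 * (M * r)
  bound-false x fx = *-cancelʳ-≤ _ _ r (begin
    sensitivityAt f x * r   ≤⟨ sensitivityAt-false c r 3≤r x fx ⟩
    M * n                   ≤⟨ *-monoʳ-≤ M n≤4r² ⟩
    M * (4 * (r * r))       ≡⟨ identity M r ⟩
    4 * (M * r) * r         ≤⟨ *-monoˡ-≤ r (*-monoˡ-≤ (M * r) {4} {48} (m≤m+n 4 44)) ⟩
    48 * (M * r) * r        ∎)
    where
    identity : ∀ M r → M * (4 * (r * r)) ≡ 4 * (M * r) * r
    identity = solve-∀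

  split : ∀ x β → f x ≡ β → sensitivityAt f x ≤ 48 * (M * r)
  split x true  = bound-true x
  split x false = bound-false x

  bound : ∀ x → sensitivityAt f x ≤ 48 * (M * r)
  bound x = split x (f x) refl

isqrt : ∀ n → ∃ λ r → r * r ≤ n × n < suc r * suc r
isqrt zero    = 0 , z≤n , s≤s z≤n
isqrt (suc n) with isqrt n
... | r , r²≤n , n<r′² with suc n <? suc r * suc r
...   | yes 1+n<r′² = r , m≤n⇒m≤1+n r²≤n , 1+n<r′²
...   | no  1+n≮r′² = suc r , ≮⇒≥ 1+n≮r′² ,
  ≤-<-trans n<r′² (*-mono-< (n<1+n (suc r)) (n<1+n (suc r)))

-- The conjunction of all bits, used for small n

allTrue? : (x : Input N) → Dec (∀ p → lookup x p ≡ true)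
allTrue? x = all? λ p → lookup x p Bool.≟ true

allTrue : BooleanFunction N
allTrue x = does (allTrue? x)

allTrue-nonConstant : Fin N → NonConstant (allTrue {N})
allTrue-nonConstant {N} p = ones , zeros , does-distinct (allTrue? ones) (allTrue? zeros)
  (lookup∘tabulate λ _ → true)
  (λ all → contradiction (trans (sym (all p)) (lookup∘tabulate (λ _ → false) p)) λ ())
  where
  ones zeros : Input N
  ones  = tabulate λ _ → true
  zeros = tabulate λ _ → false

allTrue-isProperty : IsHypergraphProperty k n allTrue
allTrue-isProperty {k} {n} x σ = does-⇔ (mk⇔ to from) (allTrue? x) (allTrue? (relabel σ x))
  where
  π = tuplePermutation σ
  relabelled : ∀ p → lookup (relabel σ x) p ≡ lookup x (π ⟨$⟩ʳ p)
  relabelled = lookup∘tabulate (lookup x ∘ (π ⟨$⟩ʳ_))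
  to : (∀ p → lookup x p ≡ true) → ∀ p → lookup (relabel σ x) p ≡ true
  to all p = trans (relabelled p) (all _)
  from : (∀ p → lookup (relabel σ x) p ≡ true) → ∀ p → lookup x p ≡ true
  from all p = trans (cong (lookup x) (sym (inverseʳ π {p})))
    (trans (sym (relabelled (π ⟨$⟩ˡ p))) (all (π ⟨$⟩ˡ p)))

sensitivity≤N : (f : BooleanFunction N) → sensitivity f ≤ N
sensitivity≤N {N} f = sensitivity≤ f λ x → count≤n _ (allFin N)

-- The bound for every n and the theorem

-- For `k = 3m + 1` the ceiling is `m + 1`, so twice the exponent `⌈k/3⌉ - 1/2` is `2m + 1`.
exponent : ∀ m → 2 * ⌈ 1 + m * 3 /3⌉ ∸ 1 ≡ suc (m + m)
exponent m = begin
  2 * ⌈ 1 + m * 3 /3⌉ ∸ 1      ≡⟨ cong (λ j → 2 * (j / 3) ∸ 1) (+-comm (1 + m * 3) 2) ⟩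
  2 * (suc m * 3 / 3) ∸ 1      ≡⟨ cong (λ q → 2 * q ∸ 1) (m*n/n≡m (suc m) 3) ⟩
  m + (suc m + 0)              ≡⟨ cong (m +_) (+-identityʳ (suc m)) ⟩
  m + suc m                    ≡⟨ +-suc m m ⟩
  suc (m + m)                  ∎
  where open ≡-Reasoning

-- The sensitivity bound is squared to clear the half in the exponent.
Bounded : (m c n : ℕ) → BooleanFunction (n ^ (1 + m * 3)) → Set
Bounded m c n f = NonConstant f × IsHypergraphProperty (1 + m * 3) n f ×
  (sensitivity f ^ 2 ≤ c ^ 2 * n ^ (2 * ⌈ 1 + m * 3 /3⌉ ∸ 1))

-- The summand 9 ^ k covers the n < 9, where ⌊√n⌋ < 3 is too small for fits-same.
constant : ℕ → ℕ
constant m = 48 + 9 ^ (1 + m * 3)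

allTrue-bounded : ∀ m n → 1 ≤ n → n < 9 → Bounded m (constant m) n allTrue
allTrue-bounded m n@(suc _) _ n<9 =
  allTrue-nonConstant (inject≤ {1} zero (m^n>0 n (1 + m * 3))) ,
  allTrue-isProperty {1 + m * 3} {n} ,
  ≤-trans (^-monoˡ-≤ 2 (≤-trans (sensitivity≤N (allTrue {n ^ (1 + m * 3)}))
            (≤-trans (^-monoˡ-≤ (1 + m * 3) (<⇒≤ n<9)) (m≤n+m _ 48))))
          (m≤m*n (constant m ^ 2) (n ^ e) {{m^n≢0 n e}})
  where
  e = 2 * ⌈ 1 + m * 3 /3⌉ ∸ 1

pattern-bounded : ∀ m n r → 1 ≤ m → 9 ≤ n → r * r ≤ n → n < suc r * suc r →
  Bounded m (constant m) n (patternFunction (coordinates {m} {n}) r)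
pattern-bounded m n r 1≤m 9≤n r²≤n n<r′² =
  patternFunction-nonConstant (coordinates {m} {n}) r 1≤r
    (≤-trans (m≤m*n r r {{>-nonZero 1≤r}}) r²≤n) (≤-trans (m≤m+n 6 3) (≤-trans 9≤n n≤M)) ,
  pattern-isProperty {m} {n} r ,
  (begin
    sensitivity (patternFunction (coordinates {m} {n}) r) ^ 2
      ≤⟨ ^-monoˡ-≤ 2 (pattern-sensitivity (coordinates {m} {n}) 3≤r n≤M n≤4r²) ⟩
    (48 * (n ^ m * r)) ^ 2
      ≡⟨ square 48 (n ^ m) r ⟩
    48 ^ 2 * (r * r * (n ^ m * n ^ m))
      -- After squaring, `r` enters only as `r * r ≤ n`, which supplies the odd factor `n`.
      ≤⟨ *-mono-≤ (^-monoˡ-≤ 2 (m≤m+n 48 (9 ^ (1 + m * 3)))) (*-monoˡ-≤ (n ^ m * n ^ m) r²≤n) ⟩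
    constant m ^ 2 * (n * (n ^ m * n ^ m))
      ≡⟨ cong (λ q → constant m ^ 2 * (n * q)) (^-distribˡ-+-* n m m) ⟨
    constant m ^ 2 * n ^ suc (m + m)
      ≡⟨ cong (λ e → constant m ^ 2 * n ^ e) (exponent m) ⟨
    constant m ^ 2 * n ^ (2 * ⌈ 1 + m * 3 /3⌉ ∸ 1) ∎)
  where
  open ≤-Reasoning

  n≤M : n ≤ n ^ m
  n≤M = ≤-trans (≤-reflexive (sym (^-identityʳ n)))
    (^-monoʳ-≤ n {{>-nonZero (≤-trans (s≤s z≤n) 9≤n)}} 1≤m)

  3≤r : 3 ≤ r
  -- If `r < 3`, then `suc r * suc r ≤ 9 ≤ n`, against the choice of `r`.
  3≤r = ≮⇒≥ λ r<3 → <⇒≱ n<r′² (≤-trans (*-mono-≤ r<3 r<3) 9≤n)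

  1≤r : 1 ≤ r
  1≤r = ≤-trans (s≤s z≤n) 3≤r

  four : ∀ r → (r + r) * (r + r) ≡ 4 * (r * r)
  four = solve-∀

  n≤4r² : n ≤ 4 * (r * r)
  -- Since `1 ≤ r`, `suc r` is at most `r + r`.
  n≤4r² = ≤-trans (<⇒≤ n<r′²)
    (≤-trans (*-mono-≤ (+-monoˡ-≤ r 1≤r) (+-monoˡ-≤ r 1≤r)) (≤-reflexive (four r)))

  square : ∀ c M r → (c * (M * r)) ^ 2 ≡ c ^ 2 * (r * r * (M * M))
  square c M r = trans (cong (c * (M * r) *_) (*-identityʳ (c * (M * r))))
    (trans (identity c M r) (cong (λ d → c * d * (r * r * (M * M))) (sym (*-identityʳ c))))
    where
    identity : ∀ c M r → c * (M * r) * (c * (M * r)) ≡ c * c * (r * r * (M * M))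
    identity = solve-∀

-- The premise `1 ≤ n` stands under the existential, so that a function is chosen for `n = 0` as
-- well.
bounded-family : ∀ m → 1 ≤ m → ∀ n → Dec (n < 9) → ∃ λ f → 1 ≤ n → Bounded m (constant m) n f
bounded-family m 1≤m n (yes n<9) = allTrue , λ 1≤n → allTrue-bounded m n 1≤n n<9
bounded-family m 1≤m n (no  n≮9) = let r , r²≤n , n<r′² = isqrt n in
  patternFunction (coordinates {m} {n}) r , λ _ → pattern-bounded m n r 1≤m (≮⇒≥ n≮9) r²≤n n<r′²

arity-form : ∀ k → k % 3 ≡ 1 → k ≡ 1 + k / 3 * 3
arity-form k k%3≡1 = trans (m≡m%n+[m/n]*n k 3) (cong (_+ k / 3 * 3) k%3≡1)

theorem4 : (k : ℕ) → k ≥ 4 → k % 3 ≡ 1 →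
    ∃[ c ] (0 < c) ×
    (Σ[ f ∈ ((n : ℕ) → BooleanFunction (n ^ k)) ]
    ((n : ℕ) → n ≥ 1 →
    NonConstant (f n) ×
    IsHypergraphProperty k n (f n) ×
    (sensitivity (f n) ^ 2 ≤ c ^ 2 * n ^ (2 * ⌈ k /3⌉ ∸ 1))))
theorem4 k k≥4 k%3≡1 = main (k / 3) (arity-form k k%3≡1) k≥4
  where
  -- With `m` and `k` as variables, the equation can be matched with `refl`; the case `m = 0` would
  -- make `k = 1`, against `k ≥ 4`.
  main : ∀ m {k} → k ≡ 1 + m * 3 → k ≥ 4 →
    ∃[ c ] (0 < c) ×
    (Σ[ f ∈ ((n : ℕ) → BooleanFunction (n ^ k)) ]
      ((n : ℕ) → n ≥ 1 →
        NonConstant (f n) ×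
        IsHypergraphProperty k n (f n) ×
        (sensitivity (f n) ^ 2 ≤ c ^ 2 * n ^ (2 * ⌈ k /3⌉ ∸ 1))))
  main zero      refl (s≤s ())
  main m@(suc _) refl _ = constant m , s≤s z≤n ,
    (λ n → proj₁ (family n)) , (λ n → proj₂ (family n))
    where
    family : ∀ n → ∃ λ f → 1 ≤ n → Bounded m (constant m) n f
    family n = bounded-family m (s≤s z≤n) n (n <? 9)
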